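{- Let $F_1$ be the disjoint union of $S_0$ and $S_{2,1^2}$. Then $\mathrm{HDE}(F_1;S_{2,1^0})=2$; consequently, for every graph $G$, $\hom(S_0;G)\cdot\hom(S_{2,1^2};G)\ge\hom(S_{2,1^0};G)^2$.
   Context: All graphs are finite; $\hom(H;G)$ is the number of graph homomorphisms from $H$ to $G$ (so $\hom$ of a disjoint union is the product of the $\hom$'s of the components). $S_0$ is a single vertex; for $k\ge0$, $S_{2,1^k}$ is the tree with vertex set $\{1,\ldots,k+3\}$ and edge set $\{\{1,j\}:2\le j\le k+2\}\cup\{\{k+2,k+3\}\}$. The homomorphism domination exponent $\mathrm{HDE}(F_1;F_2)$ of graphs $F_1,F_2$ is the maximum real $c$ such that $\hom(F_1;G)\ge\hom(F_2;G)^c$ for every graph $G$. -}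

module Defs where

open import Level using (0ℓ)
open import Data.Nat as ℕ using (ℕ; zero; suc)
import Data.Nat.Properties as ℕ
open import Data.Integer as ℤ using (+_; -[1+_])
open import Data.Rational as ℚ using (ℚ; 0ℚ; 1ℚ)
import Data.Rational.Properties as ℚ
open import Data.Fin as Fin using (Fin; toℕ; splitAt; finToFun)
import Data.Fin.Properties as Fin
open import Data.List using (length; filter; allFin)
open import Data.Product using (_×_; _,_; ∃-syntax)
open import Data.Sum as Sum using (_⊎_; inj₁; inj₂)
open import Data.Sum.Relation.Binary.Pointwise as Pointwise using (Pointwise)
open import Data.Empty using (⊥)
open import Function using (_⇔_; mk⇔; _on_; _∘_)
open import Relation.Nullary using (¬_; Dec; yes; no)
open import Relation.Nullary.Decidable using (map′; _×-dec_; _⊎-dec_; _→-dec_)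
open import Relation.Binary using (Rel; Decidable; Symmetric; Irreflexive; tri<; tri≈; tri>)
open import Relation.Binary.Morphism.Definitions using (Homomorphic₂)
open import Relation.Binary.PropositionalEquality using (_≡_; refl; subst)

------------------------------------------------------------------------
-- Finite simple graphs and homomorphism numbers

record Graph : Set₁ where
  field
    order    : ℕ
  Vertex : Set
  Vertex = Fin order
  field
    _~_      : Rel Vertex 0ℓ
    _~?_     : Decidable _~_
    ~-sym    : Symmetric _~_
    ~-irrefl : Irreflexive _≡_ _~_

open Graph using (order; Vertex)

IsHom : (H G : Graph) → (Vertex H → Vertex G) → Set
IsHom H G = Homomorphic₂ (Vertex H) (Vertex G) (Graph._~_ H) (Graph._~_ G)

isHom? : (H G : Graph) (f : Vertex H → Vertex G) → Dec (IsHom H G f)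
isHom? H G f =
  map′ (λ h {x} {y} → h x y) (λ h x y → h {x} {y})
    (Fin.all? λ x → Fin.all? λ y → (x H.~? y) →-dec (f x G.~? f y))
  where
  module H = Graph H
  module G = Graph G

-- finToFun is a bijection from Fin (n ^ m) onto the maps Fin m → Fin n.
hom : Graph → Graph → ℕ
hom H G =
  length (filter (isHom? H G ∘ finToFun) (allFin (order G ℕ.^ order H)))

infixr 6 _⊎ᴳ_

_⊎ᴳ_ : Graph → Graph → Graph
H ⊎ᴳ K = record
  { order    = order H ℕ.+ order K
  ; _~_      = Pointwise H._~_ K._~_ on splitAt (order H)
  ; _~?_     = λ x y → Pointwise.⊎-decidable H._~?_ K._~?_
                         (splitAt (order H) x) (splitAt (order H) y)
  ; ~-sym    = λ {x} {y} → Pointwise.⊎-symmetric H.~-sym K.~-sym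
                 {splitAt (order H) x} {splitAt (order H) y}
  ; ~-irrefl = λ { {x} refl e → irr (splitAt (order H) x) e }
  }
  where
  module H = Graph H
  module K = Graph K
  irr : ∀ s → ¬ Pointwise H._~_ K._~_ s s
  irr (inj₁ x) (Pointwise.inj₁ e) = H.~-irrefl refl e
  irr (inj₂ y) (Pointwise.inj₂ e) = K.~-irrefl refl e

------------------------------------------------------------------------
-- The trees S₀ and S_{2,1^k}

S₀ : Graph
S₀ = record
  { order    = 1
  ; _~_      = λ _ _ → ⊥
  ; _~?_     = λ _ _ → no λ ()
  ; ~-sym    = λ ()
  ; ~-irrefl = λ _ ()
  }

-- The vertex i of Fin (k + 3) carries the label 1 + i in {1, …, k + 3}.
label : ∀ {n} → Fin n → ℕ
label i = suc (toℕ i)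

-- The edge set in terms of labels, each edge {a, b} being listed with a < b.
S₂₁-arc : ℕ → Rel ℕ 0ℓ
S₂₁-arc k a b = (a ≡ 1 × 2 ℕ.≤ b × b ℕ.≤ k ℕ.+ 2)
              ⊎ (a ≡ k ℕ.+ 2 × b ≡ k ℕ.+ 3)

S₂₁-arc? : ∀ k → Decidable (S₂₁-arc k)
S₂₁-arc? k a b =
  ((a ℕ.≟ 1) ×-dec (2 ℕ.≤? b) ×-dec (b ℕ.≤? k ℕ.+ 2))
  ⊎-dec ((a ℕ.≟ k ℕ.+ 2) ×-dec (b ℕ.≟ k ℕ.+ 3))

S₂₁-arc-irrefl : ∀ k a → ¬ S₂₁-arc k a a
S₂₁-arc-irrefl k a (inj₁ (refl , ℕ.s≤s () , _))
S₂₁-arc-irrefl k a (inj₂ (refl , eq)) with ℕ.+-cancelˡ-≡ k 2 3 eq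
... | ()

S₂,₁^ : ℕ → Graph
S₂,₁^ k = record
  { order    = k ℕ.+ 3
  ; _~_      = λ u v → S₂₁-arc k (label u) (label v) ⊎ S₂₁-arc k (label v) (label u)
  ; _~?_     = λ u v → S₂₁-arc? k (label u) (label v) ⊎-dec S₂₁-arc? k (label v) (label u)
  ; ~-sym    = Sum.swap
  ; ~-irrefl = λ { {u} refl → Sum.[ S₂₁-arc-irrefl k (label u) , S₂₁-arc-irrefl k (label u) ] }
  }

------------------------------------------------------------------------
-- Dedekind reals

record ℝ : Set₁ where
  field
    L U         : ℚ → Set
    L-inhabited : ∃[ q ] L q
    U-inhabited : ∃[ q ] U q
    L-rounded   : ∀ q → L q ⇔ (∃[ r ] (q ℚ.< r × L r))
    U-rounded   : ∀ q → U q ⇔ (∃[ r ] (r ℚ.< q × U r))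
    disjoint    : ∀ q → ¬ (L q × U q)
    located     : ∀ {q r} → q ℚ.< r → L q ⊎ U r

open ℝ

infix 4 _≤ℝ_ _<ℝ_ _≃ℝ_

_≤ℝ_ : ℝ → ℝ → Set
x ≤ℝ y = ∀ q → L x q → L y q

_<ℝ_ : ℝ → ℝ → Set
x <ℝ y = ∃[ q ] (U x q × L y q)

_≃ℝ_ : ℝ → ℝ → Set
x ≃ℝ y = x ≤ℝ y × y ≤ℝ x

fromℚ : ℚ → ℝ
fromℚ p = record
  { L           = ℚ._< p
  ; U           = p ℚ.<_
  ; L-inhabited = p ℚ.- 1ℚ , subst (p ℚ.- 1ℚ ℚ.<_) (ℚ.+-identityʳ p)
                    (ℚ.+-monoʳ-< p (ℚ.negative⁻¹ (ℚ.- 1ℚ)))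
  ; U-inhabited = p ℚ.+ 1ℚ , subst (ℚ._< p ℚ.+ 1ℚ) (ℚ.+-identityʳ p)
                    (ℚ.+-monoʳ-< p (ℚ.positive⁻¹ 1ℚ))
  ; L-rounded   = λ q → mk⇔
      (λ q<p → let (r , q<r , r<p) = ℚ.<-dense q<p in r , q<r , r<p)
      (λ (r , q<r , r<p) → ℚ.<-trans q<r r<p)
  ; U-rounded   = λ q → mk⇔
      (λ p<q → let (r , p<r , r<q) = ℚ.<-dense p<q in r , r<q , p<r)
      (λ (r , r<q , p<r) → ℚ.<-trans p<r r<q)
  ; disjoint    = λ q (q<p , p<q) → ℚ.<-asym q<p p<q
  ; located     = loc
  }
  where
  loc : ∀ {q r} → q ℚ.< r → q ℚ.< p ⊎ p ℚ.< r
  loc {q} q<r with ℚ.<-cmp q p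
  ... | tri< q<p _ _    = inj₁ q<p
  ... | tri≈ _ refl _   = inj₂ q<r
  ... | tri> _ _ p<q    = inj₂ (ℚ.<-trans p<q q<r)

0ℝ : ℝ
0ℝ = fromℚ 0ℚ

2ℝ : ℝ
2ℝ = fromℚ (+ 2 ℚ./ 1)

------------------------------------------------------------------------
-- Comparing a real power of a natural number with a natural number

-- "x ^ r ≤ y" for x ≥ 1: raise both sides to the power of the denominator
-- of r and, when r < 0, clear the resulting negative power of x.
ℚPow≤ : ℕ → ℚ → ℕ → Set
ℚPow≤ x r y with ℚ.numerator r
... | + p      = x ℕ.^ p ℕ.≤ y ℕ.^ ℚ.denominatorℕ r
... | -[1+ p ] = 1 ℕ.≤ x ℕ.^ suc p ℕ.* y ℕ.^ ℚ.denominatorℕ r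

-- "x ^ c ≤ y".  For x ≥ 1, x ^ c is the supremum of x ^ r over rational r < c.
-- Further, 0 ^ c = 0 for c > 0 and 0 ^ 0 = 1; 0 ^ c is not defined for c < 0,
-- and the comparison then fails.
Pow≤ : ℕ → ℝ → ℕ → Set
Pow≤ zero      c y = 0ℝ <ℝ c ⊎ (c ≃ℝ 0ℝ × 1 ℕ.≤ y)
Pow≤ x@(suc _) c y = ∀ r → L c r → ℚPow≤ x r y

------------------------------------------------------------------------
-- The homomorphism domination exponent

Dominates : Graph → Graph → ℝ → Set₁
Dominates F₁ F₂ c = ∀ (G : Graph) → Pow≤ (hom F₂ G) c (hom F₁ G)

-- HDE(F₁; F₂) = c
IsHDE : Graph → Graph → ℝ → Set₁
IsHDE F₁ F₂ c = Dominates F₁ F₂ c × (∀ c′ → Dominates F₁ F₂ c′ → c′ ≤ℝ c)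

{-# OPTIONS --safe #-}

-- Write d(v) for the degree of v and w(v) for the sum of d(u) over the
-- neighbours u of v.  Then hom(S_{2,1^0}; G) = Σ w(v) and
-- hom(S_{2,1^2}; G) = Σ d(v)² w(v).  By Cauchy–Schwarz (Σ w)² ≤ n Σ w², and,
-- applied at each vertex, w(v)² ≤ d(v) Σ_{u ~ v} d(u)².  Summing the latter
-- over v and exchanging the sums gives Σ w² ≤ Σ_u d(u)² w(u).  For optimality
-- of the exponent, K₂ has hom(S_{2,1^0}) = 2 and hom(F₁) = 4 = 2².

module Submission where

open import Defs
open import Data.Nat using (_*_; _^_; _≥_)
open import Data.Product using (_×_)

open import Data.Bool using (true; false; if_then_else_)
open import Data.Fin using (Fin; zero; suc; combine; finToFun; splitAt; _↑ˡ_; _↑ʳ_)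
import Data.Fin.Properties as Fin
open import Data.Integer as ℤ using (-[1+_])
import Data.Integer.Properties as ℤ
open import Data.List using (length; filter; tabulate)
open import Data.Nat using (ℕ; zero; suc; _+_; _≤_; _<_; z≤n; s≤s; NonZero)
open import Data.Nat.Properties
open import Data.Nat.Tactic.RingSolver using (solve-∀)
open import Data.Product using (_,_; proj₁; proj₂)
open import Data.Rational as ℚ using (mkℚ; 1ℚ)
import Data.Rational.Properties as ℚ
open import Data.Sum using (_⊎_; inj₁; inj₂; [_,_])
open import Data.Sum.Relation.Binary.Pointwise as Pointwise using (Pointwise)
open import Data.Vec.Functional using (Vector; []; _∷_; _++_)
open import Function using (_∘_; _⇔_; mk⇔; Equivalence)
open import Relation.Binary.PropositionalEquality hiding ([_])
open import Relation.Nullary using (Dec; does; yes; no; contradiction)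
open import Relation.Nullary.Decidable using (_×-dec_; ¬?; does-⇔; toWitness)
open import Relation.Unary using (Pred; Decidable)
open import Algebra.Properties.Semiring.Sum +-*-semiring
  using (sum; sum-syntax; sum-cong-≗; ∑-distrib-+; ∑-comm; *-distribˡ-sum; *-distribʳ-sum)

open Graph using (order; Vertex)

-- Finite sums of natural numbers

sum-mono-≤ : ∀ {n} {f g : Vector ℕ n} → (∀ i → f i ≤ g i) → sum f ≤ sum g
sum-mono-≤ {zero}  f≤g = z≤n
sum-mono-≤ {suc n} f≤g = +-mono-≤ (f≤g zero) (sum-mono-≤ (f≤g ∘ suc))

∑-const-1 : ∀ n → ∑[ i < n ] 1 ≡ n
∑-const-1 zero    = refl
∑-const-1 (suc n) = cong suc (∑-const-1 n)

∑-↑ : ∀ m {n} (f : Vector ℕ (m + n)) →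
      ∑[ i < m + n ] f i ≡ ∑[ i < m ] f (i ↑ˡ n) + ∑[ j < n ] f (m ↑ʳ j)
∑-↑ zero    f = refl
∑-↑ (suc m) f = trans (cong (f zero +_) (∑-↑ m (f ∘ suc))) (sym (+-assoc (f zero) _ _))

∑-combine : ∀ m {n} (f : Vector ℕ (m * n)) →
            ∑[ i < m * n ] f i ≡ ∑[ i < m ] ∑[ j < n ] f (combine i j)
∑-combine zero        f = refl
∑-combine (suc m) {n} f = trans (∑-↑ n f) (cong (sum (λ j → f (j ↑ˡ m * n)) +_) (∑-combine m (f ∘ (n ↑ʳ_))))

-- Subtraction in ℕ truncates, so instead of expanding (a - b)² the induction lowers `a` and `b`
-- together: both sides lose the same amount 2(1 + a + b).
2ab≤a²+b² : ∀ a b → a * b + a * b ≤ a * a + b * b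
2ab≤a²+b² zero    b       = z≤n
2ab≤a²+b² (suc a) zero    rewrite *-zeroʳ a = z≤n
2ab≤a²+b² (suc a) (suc b) = begin
  suc a * suc b + suc a * suc b          ≡⟨ expandˡ a b ⟩
  (a * b + a * b) + 2 * (1 + a + b)      ≤⟨ +-monoˡ-≤ (2 * (1 + a + b)) (2ab≤a²+b² a b) ⟩
  (a * a + b * b) + 2 * (1 + a + b)      ≡⟨ expandʳ a b ⟨
  suc a * suc a + suc b * suc b          ∎
  where
  open ≤-Reasoning
  expandˡ : ∀ a b → suc a * suc b + suc a * suc b ≡ (a * b + a * b) + 2 * (1 + a + b)
  expandˡ = solve-∀
  expandʳ : ∀ a b → suc a * suc a + suc b * suc b ≡ (a * a + b * b) + 2 * (1 + a + b)
  expandʳ = solve-∀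

sum-*-sum : ∀ {m n} (f : Vector ℕ m) (g : Vector ℕ n) →
            sum f * sum g ≡ ∑[ i < m ] ∑[ j < n ] (f i * g j)
sum-*-sum f g = trans (*-distribʳ-sum (sum g) f) (sum-cong-≗ λ i → *-distribˡ-sum (f i) g)

-- Doubled, both sides are double sums over pairs (i, j), compared termwise by p_i p_j · 2 x_i x_j ≤
-- p_i p_j (x_i² + x_j²). The weights let one lemma serve twice: constant 1 for the sum over all
-- vertices, an adjacency row for the sum over neighbours.
weighted-cauchy-schwarz : ∀ {n} (p x : Vector ℕ n) →
  (∑[ i < n ] (p i * x i)) * (∑[ i < n ] (p i * x i)) ≤ sum p * ∑[ i < n ] (p i * (x i * x i))
weighted-cauchy-schwarz {n} p x = *-cancelˡ-≤ 2 (begin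
  2 * (sum px * sum px)
    ≡⟨ double (sum px * sum px) ⟩
  sum px * sum px + sum px * sum px
    ≡⟨ cong (λ s → s + s) (sum-*-sum px px) ⟩
  (∑[ i < n ] ∑[ j < n ] (px i * px j)) + (∑[ i < n ] ∑[ j < n ] (px i * px j))
    ≡⟨ ∑∑-distrib-+ (λ i j → px i * px j) (λ i j → px i * px j) ⟨
  ∑[ i < n ] ∑[ j < n ] (px i * px j + px i * px j)
    ≤⟨ sum-mono-≤ (λ i → sum-mono-≤ λ j → pointwise i j) ⟩
  ∑[ i < n ] ∑[ j < n ] (px² i * p j + p i * px² j)
    ≡⟨ ∑∑-distrib-+ (λ i j → px² i * p j) (λ i j → p i * px² j) ⟩
  (∑[ i < n ] ∑[ j < n ] (px² i * p j)) + (∑[ i < n ] ∑[ j < n ] (p i * px² j))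
    ≡⟨ cong₂ _+_ (sum-*-sum px² p) (sum-*-sum p px²) ⟨
  sum px² * sum p + sum p * sum px²
    ≡⟨ cong (_+ sum p * sum px²) (*-comm (sum px²) (sum p)) ⟩
  sum p * sum px² + sum p * sum px²
    ≡⟨ double (sum p * sum px²) ⟨
  2 * (sum p * sum px²) ∎)
  where
  open ≤-Reasoning
  px px² : Vector ℕ n
  px  i = p i * x i
  px² i = p i * (x i * x i)
  double : ∀ a → 2 * a ≡ a + a
  double = solve-∀
  ∑∑-distrib-+ : ∀ (f g : Fin n → Fin n → ℕ) →
    ∑[ i < n ] ∑[ j < n ] (f i j + g i j) ≡ (∑[ i < n ] ∑[ j < n ] f i j) + (∑[ i < n ] ∑[ j < n ] g i j)
  ∑∑-distrib-+ f g =
    trans (sum-cong-≗ λ i → ∑-distrib-+ (f i) (g i)) (∑-distrib-+ (sum ∘ f) (sum ∘ g))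
  factorˡ : ∀ p q a b → (p * a) * (q * b) + (p * a) * (q * b) ≡ (p * q) * (a * b + a * b)
  factorˡ = solve-∀
  factorʳ : ∀ p q a b → (p * (a * a)) * q + p * (q * (b * b)) ≡ (p * q) * (a * a + b * b)
  factorʳ = solve-∀
  pointwise : ∀ i j → px i * px j + px i * px j ≤ px² i * p j + p i * px² j
  pointwise i j = begin
    px i * px j + px i * px j                        ≡⟨ factorˡ (p i) (p j) (x i) (x j) ⟩
    (p i * p j) * (x i * x j + x i * x j)            ≤⟨ *-monoʳ-≤ (p i * p j) (2ab≤a²+b² (x i) (x j)) ⟩
    (p i * p j) * (x i * x i + x j * x j)            ≡⟨ factorʳ (p i) (p j) (x i) (x j) ⟨
    px² i * p j + p i * px² j                        ∎

-- Indicators of decidable propositions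

𝟙 : ∀ {a} {A : Set a} → Dec A → ℕ
𝟙 a? = if does a? then 1 else 0

𝟙-⇔ : ∀ {a b} {A : Set a} {B : Set b} → A ⇔ B → (a? : Dec A) (b? : Dec B) → 𝟙 a? ≡ 𝟙 b?
𝟙-⇔ A⇔B a? b? = cong (if_then 1 else 0) (does-⇔ A⇔B a? b?)

𝟙-× : ∀ {a b} {A : Set a} {B : Set b} (a? : Dec A) (b? : Dec B) → 𝟙 (a? ×-dec b?) ≡ 𝟙 a? * 𝟙 b?
𝟙-× a? b? with does a? | does b?
... | false | _     = refl
... | true  | false = refl
... | true  | true  = refl

length-filter-tabulate : ∀ {a p n} {A : Set a} {P : Pred A p} (P? : Decidable P) (f : Fin n → A) →
                         length (filter P? (tabulate f)) ≡ ∑[ i < n ] 𝟙 (P? (f i))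
length-filter-tabulate {n = zero}  P? f = refl
length-filter-tabulate {n = suc n} P? f with does (P? (f zero))
... | false = length-filter-tabulate P? (f ∘ suc)
... | true  = cong suc (length-filter-tabulate P? (f ∘ suc))

-- Sums over all maps between finite sets

-- Summing one coordinate at a time makes the sum over maps out of a concrete tree unfold to nested
-- sums over the images of its vertices.
∑ᴹ : ∀ m {n} → (Vector (Fin n) m → ℕ) → ℕ
∑ᴹ zero        g = g []
∑ᴹ (suc m) {n} g = ∑[ a < n ] ∑ᴹ m (g ∘ (a ∷_))

-- Reindexing yields maps that agree only pointwise, so a summand must respect pointwise equality to
-- be carried along.
Extensional : ∀ {m n} → (Vector (Fin n) m → ℕ) → Set
Extensional g = ∀ {f f′} → f ≗ f′ → g f ≡ g f′

∷-cong : ∀ {m n} (a : Fin n) {f f′ : Vector (Fin n) m} → f ≗ f′ → (a ∷ f) ≗ (a ∷ f′)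
∷-cong a f≗f′ zero    = refl
∷-cong a f≗f′ (suc i) = f≗f′ i

∑ᴹ-cong : ∀ m {n} {g h : Vector (Fin n) m → ℕ} → (∀ f → g f ≡ h f) → ∑ᴹ m g ≡ ∑ᴹ m h
∑ᴹ-cong zero    g≡h = g≡h []
∑ᴹ-cong (suc m) g≡h = sum-cong-≗ λ a → ∑ᴹ-cong m (g≡h ∘ (a ∷_))

*-distribˡ-∑ᴹ : ∀ m {n} c (g : Vector (Fin n) m → ℕ) → c * ∑ᴹ m g ≡ ∑ᴹ m (λ f → c * g f)
*-distribˡ-∑ᴹ zero        c g = refl
*-distribˡ-∑ᴹ (suc m) {n} c g =
  trans (*-distribˡ-sum {n} c _) (sum-cong-≗ λ a → *-distribˡ-∑ᴹ m c (g ∘ (a ∷_)))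

*-distribʳ-∑ᴹ : ∀ m {n} c (g : Vector (Fin n) m → ℕ) → ∑ᴹ m g * c ≡ ∑ᴹ m (λ f → g f * c)
*-distribʳ-∑ᴹ zero        c g = refl
*-distribʳ-∑ᴹ (suc m) {n} c g =
  trans (*-distribʳ-sum {n} c _) (sum-cong-≗ λ a → *-distribʳ-∑ᴹ m c (g ∘ (a ∷_)))

-- Induction on the first block; prepending a value commutes with `++` only pointwise, which is
-- where extensionality enters.
∑ᴹ-++ : ∀ k l {n} (g : Vector (Fin n) (k + l) → ℕ) → Extensional g →
        ∑ᴹ (k + l) g ≡ ∑ᴹ k λ f → ∑ᴹ l λ f′ → g (f ++ f′)
∑ᴹ-++ zero    l g g-ext = refl
∑ᴹ-++ (suc k) l g g-ext = sum-cong-≗ λ a →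
  trans (∑ᴹ-++ k l (g ∘ (a ∷_)) (g-ext ∘ ∷-cong a))
        (∑ᴹ-cong k λ f → ∑ᴹ-cong l λ f′ → g-ext (∷-++ a f f′))
  where
  ∷-++ : ∀ {n} a (f : Vector (Fin n) k) (f′ : Vector (Fin n) l) → (a ∷ (f ++ f′)) ≗ ((a ∷ f) ++ f′)
  ∷-++ a f f′ zero    = refl
  ∷-++ a f f′ (suc i) with splitAt k i
  ... | inj₁ _ = refl
  ... | inj₂ _ = refl

finToFun-combine : ∀ m {n} (a : Fin n) (r : Fin (n ^ m)) →
                   finToFun {n} {suc m} (combine a r) ≗ (a ∷ finToFun r)
finToFun-combine m a r zero    = cong proj₁ (Fin.remQuot-combine a r)
finToFun-combine m a r (suc i) = cong (λ z → finToFun (proj₂ z) i) (Fin.remQuot-combine a r)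

-- `finToFun` reads off the base-`n` digits of its argument, so splitting off the leading digit with
-- `combine` gives the outermost sum of `∑ᴹ`.
∑-finToFun : ∀ m {n} (g : Vector (Fin n) m → ℕ) → Extensional g →
             ∑[ k < n ^ m ] g (finToFun k) ≡ ∑ᴹ m g
∑-finToFun zero        g g-ext = trans (+-identityʳ _) (g-ext λ ())
∑-finToFun (suc m) {n} g g-ext =
  trans (∑-combine n (g ∘ finToFun))
        (sum-cong-≗ λ a →
          trans (sum-cong-≗ λ r → g-ext (finToFun-combine m a r))
                (∑-finToFun m (g ∘ (a ∷_)) (g-ext ∘ ∷-cong a)))

-- Homomorphism numbers

IsHom-≗ : ∀ H G {f f′} → f ≗ f′ → IsHom H G f → IsHom H G f′
IsHom-≗ H G f≗f′ h e = subst₂ (Graph._~_ G) (f≗f′ _) (f≗f′ _) (h e)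

𝟙-isHom-extensional : ∀ H G → Extensional (𝟙 ∘ isHom? H G)
𝟙-isHom-extensional H G {f} {f′} f≗f′ = 𝟙-⇔ isHom⇔ (isHom? H G f) (isHom? H G f′)
  where
  isHom⇔ : IsHom H G f ⇔ IsHom H G f′
  isHom⇔ = mk⇔ (λ h {x} {y} → IsHom-≗ H G f≗f′ (λ {u} {v} → h {u} {v}) {x} {y})
               (λ h {x} {y} → IsHom-≗ H G (sym ∘ f≗f′) (λ {u} {v} → h {u} {v}) {x} {y})

hom-∑ᴹ : ∀ H G → hom H G ≡ ∑ᴹ (order H) (𝟙 ∘ isHom? H G)
hom-∑ᴹ H G = trans (length-filter-tabulate (isHom? H G ∘ finToFun) (λ k → k))
                   (∑-finToFun (order H) (𝟙 ∘ isHom? H G) (𝟙-isHom-extensional H G))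

-- No edge of a disjoint union joins the two sides, so the conditions on `f` and on `f′` are
-- independent.
IsHom-++ : ∀ H K G f f′ → IsHom (H ⊎ᴳ K) G (f ++ f′) ⇔ (IsHom H G f × IsHom K G f′)
IsHom-++ H K G f f′ = mk⇔ restrict extend
  where
  module H = Graph H
  module K = Graph K
  module G = Graph G
  -- Stated for arbitrary points of the sum type, the condition can be transported along the
  -- `splitAt` equations and proved by matching on the edge.
  Preserved : (s t : Vertex H ⊎ Vertex K) → Set
  Preserved s t = Pointwise H._~_ K._~_ s t → [ f , f′ ] s G.~ [ f , f′ ] t
  restrict : IsHom (H ⊎ᴳ K) G (f ++ f′) → IsHom H G f × IsHom K G f′
  restrict h =
    (λ {x} {y} e → subst₂ Preserved (Fin.splitAt-↑ˡ (order H) x (order K)) (Fin.splitAt-↑ˡ (order H) y (order K))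
                          (h {x ↑ˡ order K} {y ↑ˡ order K}) (Pointwise.inj₁ e)) ,
    (λ {x} {y} e → subst₂ Preserved (Fin.splitAt-↑ʳ (order H) (order K) x) (Fin.splitAt-↑ʳ (order H) (order K) y)
                          (h {order H ↑ʳ x} {order H ↑ʳ y}) (Pointwise.inj₂ e))
  glue : IsHom H G f → IsHom K G f′ → ∀ s t → Preserved s t
  glue h k _ _ (Pointwise.inj₁ e) = h e
  glue h k _ _ (Pointwise.inj₂ e) = k e
  extend : IsHom H G f × IsHom K G f′ → IsHom (H ⊎ᴳ K) G (f ++ f′)
  extend (h , k) {x} {y} = glue h k (splitAt (order H) x) (splitAt (order H) y)

hom-⊎ᴳ : ∀ H K G → hom (H ⊎ᴳ K) G ≡ hom H G * hom K G
hom-⊎ᴳ H K G = begin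
  hom (H ⊎ᴳ K) G
    ≡⟨ hom-∑ᴹ (H ⊎ᴳ K) G ⟩
  ∑ᴹ (order H + order K) (𝟙 ∘ isHom? (H ⊎ᴳ K) G)
    ≡⟨ ∑ᴹ-++ (order H) (order K) _ (𝟙-isHom-extensional (H ⊎ᴳ K) G) ⟩
  (∑ᴹ (order H) λ f → ∑ᴹ (order K) λ f′ → 𝟙 (isHom? (H ⊎ᴳ K) G (f ++ f′)))
    ≡⟨ (∑ᴹ-cong (order H) λ f → ∑ᴹ-cong (order K) λ f′ → factor f f′) ⟩
  (∑ᴹ (order H) λ f → ∑ᴹ (order K) λ f′ → 𝟙 (isHom? H G f) * 𝟙 (isHom? K G f′))
    ≡⟨ (∑ᴹ-cong (order H) λ f → *-distribˡ-∑ᴹ (order K) (𝟙 (isHom? H G f)) (𝟙 ∘ isHom? K G)) ⟨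
  (∑ᴹ (order H) λ f → 𝟙 (isHom? H G f) * ∑ᴹ (order K) (𝟙 ∘ isHom? K G))
    ≡⟨ *-distribʳ-∑ᴹ (order H) _ (𝟙 ∘ isHom? H G) ⟨
  ∑ᴹ (order H) (𝟙 ∘ isHom? H G) * ∑ᴹ (order K) (𝟙 ∘ isHom? K G)
    ≡⟨ cong₂ _*_ (hom-∑ᴹ H G) (hom-∑ᴹ K G) ⟨
  hom H G * hom K G ∎
  where
  open ≡-Reasoning
  factor : ∀ f f′ → 𝟙 (isHom? (H ⊎ᴳ K) G (f ++ f′)) ≡ 𝟙 (isHom? H G f) * 𝟙 (isHom? K G f′)
  factor f f′ = trans (𝟙-⇔ (IsHom-++ H K G f f′) (isHom? (H ⊎ᴳ K) G (f ++ f′)) (isHom? H G f ×-dec isHom? K G f′))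
                      (𝟙-× (isHom? H G f) (isHom? K G f′))

-- An edge-by-edge criterion for maps out of S_{2,1^k}

IsHom-S₂,₁^ : ∀ k G (f : Vertex (S₂,₁^ k) → Vertex G) →
              (∀ x y → S₂₁-arc k (label x) (label y) → Graph._~_ G (f x) (f y)) → IsHom (S₂,₁^ k) G f
IsHom-S₂,₁^ k G f arcs {x} {y} (inj₁ e) = arcs x y e
IsHom-S₂,₁^ k G f arcs {x} {y} (inj₂ e) = Graph.~-sym G (arcs y x e)

-- Degree formulas for the homomorphism numbers, and the inequality between them

module _ (G : Graph) where
  open Graph G using (_~_; _~?_; ~-sym)

  private n = order G

  adj : Vertex G → Vertex G → ℕ
  adj a b = 𝟙 (a ~? b)

  adj-sym : ∀ a b → adj a b ≡ adj b a
  adj-sym a b = 𝟙-⇔ (mk⇔ ~-sym ~-sym) (a ~? b) (b ~? a)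

  deg : Vertex G → ℕ
  deg a = ∑[ b < n ] adj a b

  -- The `w` of the introduction: the number of walks of length two from `a`.
  nbrDeg : Vertex G → ℕ
  nbrDeg a = ∑[ b < n ] (adj a b * deg b)

  hom-S₀ : hom S₀ G ≡ n
  hom-S₀ = trans (hom-∑ᴹ S₀ G) (trans (sum-cong-≗ always) (∑-const-1 n))
    where
    always : ∀ a → 𝟙 (isHom? S₀ G (a ∷ [])) ≡ 1
    always a with isHom? S₀ G (a ∷ [])
    ... | yes _  = refl
    ... | no ¬h = contradiction (λ ()) ¬h

  -- For k = 0 the tree is a path; with one end fixed at `a` and the middle at `b`, the other end
  -- has `deg b` choices.
  hom-S₂,₁^0 : hom (S₂,₁^ 0) G ≡ ∑[ a < n ] nbrDeg a
  hom-S₂,₁^0 = trans (hom-∑ᴹ (S₂,₁^ 0) G) (sum-cong-≗ λ a → sum-cong-≗ λ b →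
      trans (sum-cong-≗ λ c → indicator a b c) (sym (*-distribˡ-sum (adj a b) (adj b))))
    where
    edges : ∀ a b c → IsHom (S₂,₁^ 0) G (a ∷ b ∷ c ∷ []) ⇔ (a ~ b × b ~ c)
    edges a b c = mk⇔
      (λ h → h {zero} {suc zero} (toWitness {a? = S₂,₁^ 0 .Graph._~?_ zero (suc zero)} _)
           , h {suc zero} {suc (suc zero)} (toWitness {a? = S₂,₁^ 0 .Graph._~?_ (suc zero) (suc (suc zero))} _))
      -- Only pairs listed from smaller to larger label need checking. Those that are not arcs
      -- violate 2 ≤ b ≤ k + 2 or are excluded by unification.
      (λ (ab , bc) {x} {y} → IsHom-S₂,₁^ 0 G (a ∷ b ∷ c ∷ []) (λ where
         zero       zero             (inj₁ (_ , s≤s () , _))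
         zero       (suc zero)       (inj₁ _) → ab
         zero       (suc (suc zero)) (inj₁ (_ , _ , s≤s (s≤s ())))
         (suc zero) (suc (suc zero)) (inj₂ _) → bc) {x} {y})
    indicator : ∀ a b c → 𝟙 (isHom? (S₂,₁^ 0) G (a ∷ b ∷ c ∷ [])) ≡ adj a b * adj b c
    indicator a b c = trans (𝟙-⇔ (edges a b c) (isHom? (S₂,₁^ 0) G _) ((a ~? b) ×-dec (b ~? c)))
                            (𝟙-× (a ~? b) (b ~? c))

  -- With the centre at `a`, the leaves `b` and `c` each contribute a factor `deg a`, and the branch
  -- through `d` to `e` contributes `nbrDeg a`.
  hom-S₂,₁^2 : hom (S₂,₁^ 2) G ≡ ∑[ a < n ] (deg a * (deg a * nbrDeg a))
  hom-S₂,₁^2 = trans (hom-∑ᴹ (S₂,₁^ 2) G) (sum-cong-≗ λ a → begin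
    ∑[ b < n ] ∑[ c < n ] ∑[ d < n ] ∑[ e < n ] 𝟙 (isHom? (S₂,₁^ 2) G (a ∷ b ∷ c ∷ d ∷ e ∷ []))
      ≡⟨ (sum-cong-≗ λ b → sum-cong-≗ λ c → sum-cong-≗ λ d → sum-cong-≗ λ e → indicator a b c d e) ⟩
    ∑[ b < n ] ∑[ c < n ] ∑[ d < n ] ∑[ e < n ] ((adj a b * adj a c) * (adj a d * adj d e))
      ≡⟨ (sum-cong-≗ λ b → sum-cong-≗ λ c → trans
           (sum-cong-≗ λ d → trans
             (sym (*-distribˡ-sum (adj a b * adj a c) (λ e → adj a d * adj d e)))
             (cong (adj a b * adj a c *_) (sym (*-distribˡ-sum (adj a d) (adj d)))))
           (sym (*-distribˡ-sum (adj a b * adj a c) (λ d → adj a d * deg d)))) ⟩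
    ∑[ b < n ] ∑[ c < n ] ((adj a b * adj a c) * nbrDeg a)
      ≡⟨ (sum-cong-≗ λ b → sym (*-distribʳ-sum (nbrDeg a) (λ c → adj a b * adj a c))) ⟩
    ∑[ b < n ] ((∑[ c < n ] (adj a b * adj a c)) * nbrDeg a)
      ≡⟨ *-distribʳ-sum (nbrDeg a) (λ b → ∑[ c < n ] (adj a b * adj a c)) ⟨
    (∑[ b < n ] ∑[ c < n ] (adj a b * adj a c)) * nbrDeg a
      ≡⟨ cong (_* nbrDeg a) (sum-*-sum (adj a) (adj a)) ⟨
    (deg a * deg a) * nbrDeg a
      ≡⟨ *-assoc (deg a) (deg a) (nbrDeg a) ⟩
    deg a * (deg a * nbrDeg a) ∎)
    where
    open ≡-Reasoning
    edges : ∀ a b c d e → IsHom (S₂,₁^ 2) G (a ∷ b ∷ c ∷ d ∷ e ∷ []) ⇔ ((a ~ b × a ~ c) × (a ~ d × d ~ e))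
    edges a b c d e = mk⇔
      (λ h → ( h {zero} {suc zero} (toWitness {a? = S₂,₁^ 2 .Graph._~?_ zero (suc zero)} _)
             , h {zero} {suc (suc zero)} (toWitness {a? = S₂,₁^ 2 .Graph._~?_ zero (suc (suc zero))} _))
           , ( h {zero} {suc (suc (suc zero))} (toWitness {a? = S₂,₁^ 2 .Graph._~?_ zero (suc (suc (suc zero)))} _)
             , h {suc (suc (suc zero))} {suc (suc (suc (suc zero)))}
                 (toWitness {a? = S₂,₁^ 2 .Graph._~?_ (suc (suc (suc zero))) (suc (suc (suc (suc zero))))} _)))
      (λ ((ab , ac) , (ad , de)) {x} {y} → IsHom-S₂,₁^ 2 G (a ∷ b ∷ c ∷ d ∷ e ∷ []) (λ where
         zero zero                         (inj₁ (_ , s≤s () , _))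
         zero (suc zero)                   (inj₁ _) → ab
         zero (suc (suc zero))             (inj₁ _) → ac
         zero (suc (suc (suc zero)))       (inj₁ _) → ad
         zero (suc (suc (suc (suc zero)))) (inj₁ (_ , _ , s≤s (s≤s (s≤s (s≤s ())))))
         (suc (suc (suc zero))) (suc (suc (suc (suc zero)))) (inj₂ _) → de) {x} {y})
    indicator : ∀ a b c d e → 𝟙 (isHom? (S₂,₁^ 2) G (a ∷ b ∷ c ∷ d ∷ e ∷ []))
                              ≡ (adj a b * adj a c) * (adj a d * adj d e)
    indicator a b c d e = trans
      (𝟙-⇔ (edges a b c d e) (isHom? (S₂,₁^ 2) G _) (((a ~? b) ×-dec (a ~? c)) ×-dec ((a ~? d) ×-dec (d ~? e))))
      (trans (𝟙-× ((a ~? b) ×-dec (a ~? c)) ((a ~? d) ×-dec (d ~? e)))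
             (cong₂ _*_ (𝟙-× (a ~? b) (a ~? c)) (𝟙-× (a ~? d) (d ~? e))))

  ∑-nbrDeg² : ∑[ a < n ] (nbrDeg a * nbrDeg a) ≤ ∑[ a < n ] (deg a * (deg a * nbrDeg a))
  ∑-nbrDeg² = begin
    ∑[ a < n ] (nbrDeg a * nbrDeg a)
      -- The weights are the adjacency row of `a`, whose total is `deg a`.
      ≤⟨ sum-mono-≤ (λ a → weighted-cauchy-schwarz (adj a) deg) ⟩
    ∑[ a < n ] (deg a * ∑[ b < n ] (adj a b * (deg b * deg b)))
      ≡⟨ (sum-cong-≗ λ a → *-distribˡ-sum (deg a) (λ b → adj a b * (deg b * deg b))) ⟩
    ∑[ a < n ] ∑[ b < n ] (deg a * (adj a b * (deg b * deg b)))
      ≡⟨ ∑-comm (λ a b → deg a * (adj a b * (deg b * deg b))) ⟩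
    ∑[ b < n ] ∑[ a < n ] (deg a * (adj a b * (deg b * deg b)))
      -- By symmetry of adjacency, the inner sum over `a` collects the degrees of the neighbours of
      -- `b`.
      ≡⟨ (sum-cong-≗ λ b → trans (sum-cong-≗ λ a → regroup a b)
                                 (sym (*-distribˡ-sum (deg b * deg b) (λ a → adj b a * deg a)))) ⟩
    ∑[ b < n ] ((deg b * deg b) * nbrDeg b)
      ≡⟨ (sum-cong-≗ λ b → *-assoc (deg b) (deg b) (nbrDeg b)) ⟩
    ∑[ b < n ] (deg b * (deg b * nbrDeg b)) ∎
    where
    open ≤-Reasoning
    rearrange : ∀ x y z → x * (y * (z * z)) ≡ (z * z) * (y * x)
    rearrange = solve-∀
    regroup : ∀ a b → deg a * (adj a b * (deg b * deg b)) ≡ (deg b * deg b) * (adj b a * deg a)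
    regroup a b = trans (rearrange (deg a) (adj a b) (deg b))
                        (cong (λ z → (deg b * deg b) * (z * deg a)) (adj-sym a b))

  hom-S₂,₁^0² : hom S₀ G * hom (S₂,₁^ 2) G ≥ hom (S₂,₁^ 0) G ^ 2
  hom-S₂,₁^0² = begin
    hom (S₂,₁^ 0) G ^ 2
      ≡⟨ cong (_^ 2) hom-S₂,₁^0 ⟩
    sum nbrDeg ^ 2
      ≡⟨ cong (sum nbrDeg *_) (*-identityʳ (sum nbrDeg)) ⟩
    sum nbrDeg * sum nbrDeg
      -- Weights 1 are inserted to match the weighted inequality; their total is the number of
      -- vertices.
      ≡⟨ cong (λ z → z * z) (sum-cong-≗ λ a → sym (*-identityˡ (nbrDeg a))) ⟩
    (∑[ a < n ] (1 * nbrDeg a)) * (∑[ a < n ] (1 * nbrDeg a))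
      ≤⟨ weighted-cauchy-schwarz (λ _ → 1) nbrDeg ⟩
    (∑[ a < n ] 1) * ∑[ a < n ] (1 * (nbrDeg a * nbrDeg a))
      ≡⟨ cong₂ _*_ (∑-const-1 n) (sum-cong-≗ λ a → *-identityˡ (nbrDeg a * nbrDeg a)) ⟩
    n * ∑[ a < n ] (nbrDeg a * nbrDeg a)
      ≤⟨ *-monoʳ-≤ n ∑-nbrDeg² ⟩
    n * ∑[ a < n ] (deg a * (deg a * nbrDeg a))
      ≡⟨ cong₂ _*_ hom-S₀ hom-S₂,₁^2 ⟨
    hom S₀ G * hom (S₂,₁^ 2) G ∎
    where open ≤-Reasoning

-- The exponent

-- For r = p/q with 0 ≤ p < 2q, x ≥ 1 gives x^p ≤ x^(2q) = (x²)^q ≤ y^q. For negative r the two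
-- factors of the cleared product are each at least 1.
ℚPow≤-square : ∀ x r y → .{{NonZero x}} → r ℚ.< ℤ.+ 2 ℚ./ 1 → x ^ 2 ≤ y → ℚPow≤ x r y
ℚPow≤-square x (mkℚ (ℤ.+ p) q-1 _) y (ℚ.*<* p<2q) x²≤y = begin
  x ^ p             ≤⟨ ^-monoʳ-≤ x (≤-trans (≤-reflexive (sym (*-identityʳ p))) (<⇒≤ (ℤ.drop‿+<+ p<2q′))) ⟩
  x ^ (2 * suc q-1) ≡⟨ ^-*-assoc x 2 (suc q-1) ⟨
  (x ^ 2) ^ suc q-1 ≤⟨ ^-monoˡ-≤ (suc q-1) x²≤y ⟩
  y ^ suc q-1       ∎
  where
  open ≤-Reasoning
  -- The factor 1 is the denominator of the rational 2 after cross-multiplication.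
  p<2q′ : ℤ.+ (p * 1) ℤ.< ℤ.+ (2 * suc q-1)
  p<2q′ = subst₂ ℤ._<_ (sym (ℤ.pos-* p 1)) (sym (ℤ.pos-* 2 (suc q-1))) p<2q
ℚPow≤-square x (mkℚ -[1+ p ] q-1 _) y _ x²≤y =
  *-mono-≤ (m^n>0 x (suc p)) (≤-trans (m^n>0 (x ^ 2) {{m^n≢0 x 2}} (suc q-1)) (^-monoˡ-≤ (suc q-1) x²≤y))

Pow≤-square : ∀ x y → x ^ 2 ≤ y → Pow≤ x 2ℝ y
-- Base 0 only asks that the exponent be positive; the rational 1 separates 0 from 2.
Pow≤-square zero      y _    = inj₁ (1ℚ , toWitness {a? = _ ℚ.<? _} _ , toWitness {a? = _ ℚ.<? _} _)
Pow≤-square x@(suc _) y x²≤y = λ r r<2 → ℚPow≤-square x r y r<2 x²≤y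

-- Optimality of the exponent, tested on a single edge

^-cancelˡ-≤ : ∀ m → 1 < m → ∀ {n o} → m ^ n ≤ m ^ o → n ≤ o
^-cancelˡ-≤ m 1<m mⁿ≤mᵒ = ≮⇒≥ λ o<n → ≤⇒≯ mⁿ≤mᵒ (^-monoʳ-< m 1<m o<n)

-- The numbers 2 and 4 are the two counts in `K₂`. Since 4^q = 2^(2q), comparing exponents of 2
-- bounds p by 2q; a negative r lies below 2 anyway.
ℚPow≤-2-4 : ∀ r → ℚPow≤ 2 r 4 → r ℚ.≤ ℤ.+ 2 ℚ./ 1
ℚPow≤-2-4 (mkℚ (ℤ.+ p) q-1 _) 2ᵖ≤4^q = ℚ.*≤*
  (subst₂ ℤ._≤_ (ℤ.pos-* p 1) (ℤ.pos-* 2 (suc q-1))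
    (ℤ.+≤+ (≤-trans (≤-reflexive (*-identityʳ p)) p≤2q)))
  where
  p≤2q : p ≤ 2 * suc q-1
  p≤2q = ^-cancelˡ-≤ 2 (s≤s (s≤s z≤n)) (≤-trans 2ᵖ≤4^q (≤-reflexive (^-*-assoc 2 2 (suc q-1))))
ℚPow≤-2-4 (mkℚ -[1+ p ] q-1 _) _ = ℚ.*≤* ℤ.-≤+

K₂ : Graph
K₂ = record
  { order    = 2
  ; _~_      = _≢_
  ; _~?_     = λ x y → ¬? (x Fin.≟ y)
  ; ~-sym    = ≢-sym
  ; ~-irrefl = λ x≡y x≢y → x≢y x≡y
  }

theorem3p6 : IsHDE (S₀ ⊎ᴳ S₂,₁^ 2) (S₂,₁^ 0) 2ℝ
    × (∀ (G : Graph) → hom S₀ G * hom (S₂,₁^ 2) G ≥ hom (S₂,₁^ 0) G ^ 2)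
theorem3p6 = (dominates , optimal) , hom-S₂,₁^0²
  where
  dominates : Dominates (S₀ ⊎ᴳ S₂,₁^ 2) (S₂,₁^ 0) 2ℝ
  dominates G = Pow≤-square _ _
    (≤-trans (hom-S₂,₁^0² G) (≤-reflexive (sym (hom-⊎ᴳ S₀ (S₂,₁^ 2) G))))

  optimal : ∀ c → Dominates (S₀ ⊎ᴳ S₂,₁^ 2) (S₂,₁^ 0) c → c ≤ℝ 2ℝ
  -- The test on `K₂` yields only r ≤ 2, while the cut of 2 demands strict inequality; roundedness
  -- supplies a larger r still in the lower cut.
  optimal c dom q q∈L with r , q<r , r∈L ← Equivalence.to (ℝ.L-rounded c q) q∈L =
    -- The path count in `K₂` evaluates to 2. Multiplicativity turns the other count into a product
    -- of two smaller ones, which evaluates to 2 · 2 = 4.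
    ℚ.<-≤-trans q<r (ℚPow≤-2-4 r (subst (ℚPow≤ 2 r) (hom-⊎ᴳ S₀ (S₂,₁^ 2) K₂) (dom K₂ r r∈L)))
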